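{- Let $n\ge m\ge 0$ be integers with $n-m\equiv 1 \pmod 2$. Then $$\int_{ -\infty}^{\infty} f_n(x) f_m(x)\,dx = \frac{1}{2}\binom{n+m+1}{\frac{n+m+1}{2}}.$$
   Context: For $A\subseteq\mathbb{R}$, $\chi_A$ denotes the characteristic function of $A$. Define functions $f_n:\mathbb{R}\to\mathbb{R}$, $n = 0,1,2,\dots$, recursively by $f_0 = \chi_{(-1/2,1/2)}$ and $f_{n+1}(x) = f_n(x+1/2) + f_n(x-1/2)$ for all $x\in\mathbb{R}$. -}

module Defs where

open import Algebra.Bundles using (CommutativeRing)
open import Algebra.Core using (Op₁; Op₂)
import Algebra.Definitions.RawMonoid as RawMonoidMultiples
open import Algebra.Structures using (IsCommutativeRing)
open import Data.Bool.Base using (if_then_else_)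
open import Data.Nat.Base using (ℕ; zero; suc)
open import Data.Product.Base using (∃; _×_; _,_; proj₁)
open import Data.Unit.Polymorphic.Base using (⊤)
open import Level using (Level; _⊔_) renaming (suc to lsuc)
import Relation.Binary.Construct.StrictToNonStrict as StrictToNonStrict
open import Relation.Binary.Core using (Rel)
open import Relation.Binary.Structures using (IsStrictTotalOrder)
open import Relation.Nullary.Decidable.Core using (does; _×-dec_)
open import Relation.Nullary.Negation.Core using (¬_)
open import Relation.Unary using (Pred; Decidable)

-- The real numbers, given axiomatically as a complete ordered field.  This is
-- the classical field ℝ: the order is trichotomous, and `supremum` has no
-- locatedness hypothesis.  The axioms determine ℝ up to isomorphism.
record Reals (c ℓ₁ ℓ₂ : Level) : Set (lsuc (c ⊔ ℓ₁ ⊔ ℓ₂)) where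
  infix  8 -_
  infixl 7 _*_
  infixl 6 _+_ _-_
  infix  4 _≈_ _<_
  field
    Carrier            : Set c
    _≈_                : Rel Carrier ℓ₁
    _<_                : Rel Carrier ℓ₂
    _+_ _*_            : Op₂ Carrier
    -_                 : Op₁ Carrier
    0# 1#              : Carrier
    isCommutativeRing  : IsCommutativeRing _≈_ _+_ _*_ -_ 0# 1#
    isStrictTotalOrder : IsStrictTotalOrder _≈_ _<_
    inverse            : ∀ x → ¬ (x ≈ 0#) → ∃ λ y → x * y ≈ 1#
    0<1                : 0# < 1#
    +-monoˡ-<          : ∀ {x y} z → x < y → x + z < y + z
    *-pos              : ∀ {x y} → 0# < x → 0# < y → 0# < x * y

  open StrictToNonStrict _≈_ _<_ public using (_≤_)

  field
    supremum : (P : Pred Carrier (c ⊔ ℓ₁ ⊔ ℓ₂)) →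
               (∃ λ x → P x) →
               (∃ λ b → ∀ x → P x → x ≤ b) →
               ∃ λ s → (∀ x → P x → x ≤ s) ×
                       (∀ y → y < s → ∃ λ x → P x × y < x)

  commutativeRing : CommutativeRing c ℓ₁
  commutativeRing = record { isCommutativeRing = isCommutativeRing }

  open IsStrictTotalOrder isStrictTotalOrder public using (compare; _<?_)

  _-_ : Op₂ Carrier
  x - y = x + (- y)

module OverReals {c ℓ₁ ℓ₂} (R : Reals c ℓ₁ ℓ₂) where

  open Reals R
  private
    module Ring = CommutativeRing commutativeRing
    module Order = IsStrictTotalOrder isStrictTotalOrder
    module Multiples = RawMonoidMultiples Ring.+-rawMonoid

  fromℕ : ℕ → Carrier
  fromℕ n = n Multiples.× 1#

  2≉0 : ¬ (1# + 1# ≈ 0#)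
  2≉0 2≈0 = Order.irrefl (Ring.sym 2≈0) (Order.trans 0<1 1<2)
    where
    1<2 : 1# < 1# + 1#
    1<2 = Order.<-respˡ-≈ (Ring.+-identityˡ 1#) (+-monoˡ-< 1# 0<1)

  ½ : Carrier
  ½ = proj₁ (inverse (1# + 1#) 2≉0)

  ∣_∣ : Op₁ Carrier
  ∣ x ∣ = if does (x <? 0#) then - x else x

  χ : ∀ {p} {A : Pred Carrier p} → Decidable A → Carrier → Carrier
  χ A? x = if does (A? x) then 1# else 0#

  OpenInterval : Carrier → Carrier → Pred Carrier ℓ₂
  OpenInterval a b x = a < x × x < b

  openInterval? : ∀ a b → Decidable (OpenInterval a b)
  openInterval? a b x = (a <? x) ×-dec (x <? b)

  f : ℕ → Carrier → Carrier
  f zero    x = χ (openInterval? (- ½) ½) x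
  f (suc n) x = f n (x + ½) + f n (x - ½)

  -- Tagged partitions of [a , b], listed from the left endpoint: in
  -- `cell t x a≤t t≤x P` the first cell is [a , x], its tag is t, and P is a
  -- tagged partition of [x , b].
  data TaggedPartition (b : Carrier) : Carrier → Set (c ⊔ ℓ₁ ⊔ ℓ₂) where
    end  : ∀ {a} → a ≈ b → TaggedPartition b a
    cell : ∀ {a} t x → a ≤ t → t ≤ x → TaggedPartition b x →
           TaggedPartition b a

  riemannSum : (Carrier → Carrier) →
               ∀ {a b} → TaggedPartition b a → Carrier
  riemannSum g         (end _)          = 0#
  riemannSum g {a = a} (cell t x _ _ P) = g t * (x - a) + riemannSum g P

  MeshBelow : Carrier → ∀ {a b} → TaggedPartition b a → Set ℓ₂
  MeshBelow δ         (end _)          = ⊤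
  MeshBelow δ {a = a} (cell t x _ _ P) = (x - a < δ) × MeshBelow δ P

  IsRiemannIntegral : (Carrier → Carrier) → (a b I : Carrier) →
                      Set (c ⊔ ℓ₁ ⊔ ℓ₂)
  IsRiemannIntegral g a b I =
    ∀ ε → 0# < ε → ∃ λ δ → 0# < δ ×
      (∀ (P : TaggedPartition b a) → MeshBelow δ P →
        ∣ riemannSum g P - I ∣ < ε)

  -- The integral of g over (-∞ , ∞) exists and equals I: g is Riemann
  -- integrable on every compact interval, and the integrals over [a , b] tend
  -- to I as a → -∞ and b → ∞ independently.
  record IsIntegralOverℝ (g : Carrier → Carrier) (I : Carrier) :
                         Set (c ⊔ ℓ₁ ⊔ ℓ₂) where
    field
      ∫[_,_]     : Carrier → Carrier → Carrier
      isIntegral : ∀ a b → a ≤ b → IsRiemannIntegral g a b (∫[_,_] a b)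
      converges  : ∀ ε → 0# < ε → ∃ λ M →
                   ∀ a b → a ≤ - M → M ≤ b → ∣ ∫[_,_] a b - I ∣ < ε

-- Shifting the two factors independently, put I(n,m,s,t) = ∫ fₙ(x+s) fₘ(x+t) dx.
-- If s − t + (n+m+1)/2 is an integer k then I(n,m,s,t) = ½ C(n+m+1, k): the
-- recursions of fₙ and fₘ both become Pascal's rule, and for n = m = 0 two unit
-- intervals offset by an odd multiple of ½ overlap in length ½ or not at all.
-- The theorem is the case s = t = 0.

module Submission where

open import Algebra.Bundles using (CommutativeRing)
import Algebra.Properties.AbelianGroup as AbelianGroupProperties
import Algebra.Properties.Monoid.Mult as MonoidMult
import Algebra.Properties.Ring as RingProperties
import Algebra.Properties.Semiring.Mult as SemiringMult
import Algebra.Solver.Ring as RingSolver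
open import Algebra.Solver.Ring.AlmostCommutativeRing
  using (fromCommutativeRing; _-Raw-AlmostCommutative⟶_)
open import Data.Bool.Base using (if_then_else_)
open import Data.Empty using (⊥)
open import Data.Integer.Base as ℤ using (ℤ; +_; -[1+_]; _⊖_)
import Data.Integer.Properties as ℤ
open import Data.Maybe.Base using (Maybe; just; nothing)
import Data.Nat.Base as ℕ
import Data.Nat.Properties as ℕ
import Data.Nat.DivMod as ℕ
import Data.Nat.Combinatorics as ℕ
open import Data.Nat.Tactic.RingSolver using (solve-∀)
open import Data.Product.Base using (∃; _×_; _,_; proj₁; proj₂)
open import Data.Sum.Base using (inj₁; inj₂)
open import Data.Unit.Polymorphic.Base using (tt)
open import Function.Base using (_∘_)
import Relation.Binary.Construct.StrictToNonStrict as StrictToNonStrict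
open import Relation.Binary.Definitions using (tri<; tri≈; tri>)
open import Relation.Binary.PropositionalEquality as ≡ using (_≡_)
open import Relation.Binary.Structures using (IsStrictTotalOrder)
open import Relation.Nullary.Decidable.Core using (yes; no; does; ¬?)
open import Relation.Nullary.Decidable using (dec-true; dec-false; decidable-stable)
open import Relation.Nullary.Negation.Core using (¬_; contradiction)
open import Relation.Unary using (Pred; Decidable)

open import Defs

-- Binomial coefficients with integer lower index.

binomial : ℕ.ℕ → ℤ → ℕ.ℕ
binomial N (+ k)    = N ℕ.C k
binomial N -[1+ k ] = 0

-- The value 0 at negative lower indices covers k = 0, where the second summand has lower index -1,
-- so the induction on integrals has no boundary case.
binomial-pascal : ∀ N k → binomial N k ℕ.+ binomial N (ℤ.pred k) ≡ binomial (ℕ.suc N) k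
binomial-pascal N (+ ℕ.zero)  = ≡.refl
binomial-pascal N (+ ℕ.suc k) = ≡.trans
  (≡.cong (N ℕ.C ℕ.suc k ℕ.+_) (≡.cong (binomial N) (ℤ.[1+m]⊖[1+n]≡m⊖n k 0)))
  (≡.trans (ℕ.+-comm (N ℕ.C ℕ.suc k) (N ℕ.C k)) (ℕ.nCk+nC[k+1]≡[n+1]C[k+1] N k))
binomial-pascal N -[1+ k ]    = ≡.refl

-- Ring arithmetic: half-integers, the map from ℤ, and the ring solver.

module OrderedField {c ℓ₁ ℓ₂} (R : Reals c ℓ₁ ℓ₂) where

  open Reals R
  open OverReals R
  open CommutativeRing commutativeRing public
    using ( refl; sym; trans; reflexive; ring; semiring; +-cong; +-congˡ; +-congʳ
          ; *-cong; *-congˡ; *-congʳ; -‿cong; +-identityˡ; +-identityʳ; +-comm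
          ; *-identityˡ; *-identityʳ; *-comm; zeroˡ; zeroʳ; distribˡ; distribʳ
          ; -‿inverseʳ; +-assoc)
  private
    module Ring = CommutativeRing commutativeRing
    module Order = IsStrictTotalOrder isStrictTotalOrder
    module Weak = StrictToNonStrict _≈_ _<_
    open RingProperties ring
    module Additive = AbelianGroupProperties Ring.+-abelianGroup
    module Multiple = MonoidMult Ring.+-monoid

  infix 8 _×½
  -- Offsets such as (n+m+1)/2 are kept as repeated sums of `½`: a successor then splits off one `½`
  -- by computation, which is how an offset changes along the recursion of `f`.
  _×½ : ℕ.ℕ → Carrier
  n ×½ = n Multiple.× ½

  ι : ℤ → Carrier
  ι (+ n)    = fromℕ n
  ι -[1+ n ] = - fromℕ (ℕ.suc n)

  fromℕ-homo-+ : ∀ m n → fromℕ (m ℕ.+ n) ≈ fromℕ m + fromℕ n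
  fromℕ-homo-+ = Multiple.×-homo-+ 1#

  fromℕ-homo-* : ∀ m n → fromℕ (m ℕ.* n) ≈ fromℕ m * fromℕ n
  fromℕ-homo-* = SemiringMult.×1-homo-* semiring

  x-0≈x : ∀ x → x - 0# ≈ x
  x-0≈x x = trans (+-congˡ Additive.ε⁻¹≈ε) (+-identityʳ x)

  private
    [z+x]-[z+y]≈x-y : ∀ x y z → (z + x) - (z + y) ≈ x - y
    [z+x]-[z+y]≈x-y x y z =
      trans (+-cong (+-comm z x) (sym (Additive.⁻¹-∙-comm z y)))
      (trans (+-assoc x z (- z - y))
      (+-congˡ (trans (sym (+-assoc z (- z) (- y)))
               (trans (+-congʳ (-‿inverseʳ z)) (+-identityˡ (- y))))))

  ι-⊖ : ∀ m n → ι (m ⊖ n) ≈ fromℕ m - fromℕ n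
  ι-⊖ m         ℕ.zero    = sym (x-0≈x _)
  ι-⊖ ℕ.zero    (ℕ.suc n) = sym (+-identityˡ _)
  ι-⊖ (ℕ.suc m) (ℕ.suc n) =
    trans (reflexive (≡.cong ι (ℤ.[1+m]⊖[1+n]≡m⊖n m n)))
    (trans (ι-⊖ m n) (sym ([z+x]-[z+y]≈x-y _ _ 1#)))

  ι-homo-+ : ∀ i j → ι (i ℤ.+ j) ≈ ι i + ι j
  ι-homo-+ (+ m)    (+ n)    = fromℕ-homo-+ m n
  ι-homo-+ (+ m)    -[1+ n ] = ι-⊖ m (ℕ.suc n)
  ι-homo-+ -[1+ m ] (+ n)    = trans (ι-⊖ n (ℕ.suc m)) (+-comm _ _)
  ι-homo-+ -[1+ m ] -[1+ n ] =
    trans (-‿cong (trans (reflexive (≡.cong fromℕ (≡.cong ℕ.suc (≡.sym (ℕ.+-suc m n)))))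
                         (fromℕ-homo-+ (ℕ.suc m) (ℕ.suc n))))
          (sym (Additive.⁻¹-∙-comm _ _))

  ι-homo-neg : ∀ i → ι (ℤ.- i) ≈ - ι i
  ι-homo-neg (+ ℕ.zero)  = sym Additive.ε⁻¹≈ε
  ι-homo-neg (+ ℕ.suc n) = refl
  ι-homo-neg -[1+ n ]    = sym (Additive.⁻¹-involutive _)

  ι-homo-+* : ∀ m j → ι (+ m ℤ.* j) ≈ fromℕ m * ι j
  ι-homo-+* m (+ n)    = trans (reflexive (≡.cong ι (≡.sym (ℤ.pos-* m n)))) (fromℕ-homo-* m n)
  ι-homo-+* m -[1+ n ] =
    trans (reflexive (≡.cong ι (≡.sym (ℤ.neg-distribʳ-* (+ m) (+ ℕ.suc n)))))
    (trans (ι-homo-neg (+ m ℤ.* + ℕ.suc n))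
    (trans (-‿cong (ι-homo-+* m (+ ℕ.suc n))) (-‿distribʳ-* _ _)))

  ι-homo-* : ∀ i j → ι (i ℤ.* j) ≈ ι i * ι j
  ι-homo-* (+ m)    j = ι-homo-+* m j
  ι-homo-* -[1+ m ] j =
    trans (reflexive (≡.cong ι (≡.sym (ℤ.neg-distribˡ-* (+ ℕ.suc m) j))))
    (trans (ι-homo-neg (+ ℕ.suc m ℤ.* j))
    (trans (-‿cong (ι-homo-+* (ℕ.suc m) j)) (-‿distribˡ-* _ _)))

  private
    -- Integer coefficients let the solver see by computation that, say, 1 - 1 vanishes, which it
    -- could not do with abstract field elements. The constant `con (+ 0)` computes to `0#`.
    ι-morphism : ℤ.+-*-rawRing -Raw-AlmostCommutative⟶ fromCommutativeRing commutativeRing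
    ι-morphism = record
      { ⟦_⟧    = ι
      ; +-homo = ι-homo-+
      ; *-homo = ι-homo-*
      ; -‿homo = ι-homo-neg
      ; 0-homo = refl
      ; 1-homo = +-identityʳ 1#
      }

    ι-≟ : ∀ i j → Maybe (ι i ≈ ι j)
    ι-≟ i j with i ℤ.≟ j
    ... | yes i≡j = just (reflexive (≡.cong ι i≡j))
    ... | no  _   = nothing

  open RingSolver ℤ.+-*-rawRing (fromCommutativeRing commutativeRing) ι-morphism ι-≟ public
    using (solve; _:=_; _:+_; _:-_; _:*_; :-_; con)

  -- Deducing one equation from another becomes a pure ring identity between differences, which the
  -- solver settles. The two `from-difference` lemmas for the order play the same role for
  -- inequalities.
  ≈-from-difference : ∀ {x y u v} → u ≈ v → x - y ≈ u - v → x ≈ y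
  ≈-from-difference {x} {y} {u} {v} u≈v eq = Additive.x∙y⁻¹≈ε⇒x≈y x y
    (trans eq (trans (+-congʳ u≈v) (-‿inverseʳ v)))

  -- Order.

  ≤-refl : ∀ {x} → x ≤ x
  ≤-refl = inj₂ refl

  <-trans : ∀ {x y z} → x < y → y < z → x < z
  <-trans = Order.trans

  <-respˡ-≈ : ∀ {x y z} → x ≈ y → x < z → y < z
  <-respˡ-≈ = Order.<-respˡ-≈

  <-respʳ-≈ : ∀ {x y z} → x ≈ y → z < x → z < y
  <-respʳ-≈ = Order.<-respʳ-≈

  ≤-trans : ∀ {x y z} → x ≤ y → y ≤ z → x ≤ z
  ≤-trans = Weak.trans Order.isEquivalence Order.<-resp-≈ Order.trans

  <-≤-trans : ∀ {x y z} → x < y → y ≤ z → x < z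
  <-≤-trans = Weak.<-≤-trans Order.trans Order.<-respʳ-≈

  ≤-<-trans : ∀ {x y z} → x ≤ y → y < z → x < z
  ≤-<-trans = Weak.≤-<-trans sym Order.trans Order.<-respˡ-≈

  ≤⇒≯ : ∀ {x y} → x ≤ y → ¬ (y < x)
  ≤⇒≯ x≤y y<x = Order.irrefl refl (≤-<-trans x≤y y<x)

  ≮⇒≥ : ∀ {x y} → ¬ (x < y) → y ≤ x
  ≮⇒≥ {x} {y} x≮y with compare x y
  ... | tri< x<y _ _ = contradiction x<y x≮y
  ... | tri≈ _ x≈y _ = inj₂ (sym x≈y)
  ... | tri> _ _ y<x = inj₁ y<x

  <-from-difference : ∀ {x y u v} → x < y → y - x ≈ v - u → u < v
  <-from-difference {x} {y} {u} {v} x<y eq =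
    <-respˡ-≈ (solve 2 (λ x u → x :+ (u :- x) := u) refl x u)
    (<-respʳ-≈ (≈-from-difference eq
      (solve 4 (λ x y u v → (y :+ (u :- x)) :- v := (y :- x) :- (v :- u)) refl x y u v))
    (+-monoˡ-< (u - x) x<y))

  ≤-from-difference : ∀ {x y u v} → x ≤ y → y - x ≈ v - u → u ≤ v
  ≤-from-difference (inj₁ x<y) eq = inj₁ (<-from-difference x<y eq)
  ≤-from-difference {x} {y} {u} {v} (inj₂ x≈y) eq = inj₂ (≈-from-difference x≈y
    (trans (solve 2 (λ u v → u :- v := :- (v :- u)) refl u v)
    (trans (-‿cong (sym eq)) (solve 2 (λ x y → :- (y :- x) := x :- y) refl x y))))

  +-monoʳ-≤ : ∀ {x y} z → x ≤ y → z + x ≤ z + y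
  +-monoʳ-≤ {x} {y} z x≤y = ≤-from-difference x≤y
    (solve 3 (λ x y z → y :- x := (z :+ y) :- (z :+ x)) refl x y z)

  +-mono-≤ : ∀ {x y u v} → x ≤ y → u ≤ v → x + u ≤ y + v
  +-mono-≤ {x} {y} {u} {v} x≤y u≤v = ≤-trans (+-monoʳ-≤ x u≤v)
    (≤-from-difference x≤y (solve 3 (λ x y v → y :- x := (y :+ v) :- (x :+ v)) refl x y v))

  +-mono-<-≤ : ∀ {x y u v} → x < y → u ≤ v → x + u < y + v
  +-mono-<-≤ {x} {u = u} x<y u≤v = <-≤-trans (+-monoˡ-< u x<y) (+-monoʳ-≤ _ u≤v)

  +-mono-< : ∀ {x y u v} → x < y → u < v → x + u < y + v
  +-mono-< x<y u<v = +-mono-<-≤ x<y (inj₁ u<v)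

  1≈½+½ : 1# ≈ ½ + ½
  1≈½+½ = trans (sym (proj₂ (inverse (1# + 1#) 2≉0)))
    (trans (distribʳ ½ 1# 1#) (+-cong (*-identityˡ ½) (*-identityˡ ½)))

  0<½ : 0# < ½
  0<½ with 0# <? ½
  ... | yes p = p
  ... | no  n = contradiction 0<1
    (≤⇒≯ (≤-trans (inj₂ 1≈½+½) (≤-trans (+-mono-≤ (≮⇒≥ n) (≮⇒≥ n)) (inj₂ (+-identityˡ 0#)))))

  ½*x+½*x≈x : ∀ x → ½ * x + ½ * x ≈ x
  ½*x+½*x≈x x = trans (sym (distribʳ x ½ ½)) (trans (*-congʳ (sym 1≈½+½)) (*-identityˡ x))

  0≤fromℕ : ∀ n → 0# ≤ fromℕ n
  0≤fromℕ ℕ.zero    = ≤-refl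
  0≤fromℕ (ℕ.suc n) =
    ≤-trans (inj₂ (sym (+-identityˡ 0#))) (+-mono-≤ (inj₁ 0<1) (0≤fromℕ n))

  ×½-double : ∀ k → (k ℕ.* 2) ×½ ≈ fromℕ k
  ×½-double ℕ.zero    = refl
  ×½-double (ℕ.suc k) =
    trans (sym (+-assoc ½ ½ _)) (+-cong (sym 1≈½+½) (×½-double k))

  ι-pred : ∀ k → ι (ℤ.pred k) ≈ ι k - 1#
  ι-pred k = trans (ι-homo-+ ℤ.-1ℤ k)
    (trans (+-congʳ (-‿cong (+-identityʳ 1#))) (+-comm (- 1#) (ι k)))

  upper-bound : ∀ x y → ∃ λ z → (x ≤ z) × (y ≤ z)
  upper-bound x y with x <? y
  ... | yes x<y = y , inj₁ x<y , ≤-refl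
  ... | no  x≮y = x , ≤-refl , ≮⇒≥ x≮y

  positive-lower-bound : ∀ x y → 0# < x → 0# < y → ∃ λ z → 0# < z × (z ≤ x) × (z ≤ y)
  positive-lower-bound x y 0<x 0<y with x <? y
  ... | yes x<y = x , 0<x , ≤-refl , inj₁ x<y
  ... | no  x≮y = y , 0<y , ≮⇒≥ x≮y , ≤-refl

  -- Bounds on absolute values.

  neg-mono-≤ : ∀ {x y} → x ≤ y → - y ≤ - x
  neg-mono-≤ {x} {y} x≤y = ≤-from-difference x≤y
    (solve 2 (λ x y → y :- x := (:- x) :- (:- y)) refl x y)

  -- Together with the elimination rule below, this confines the case split on the sign of x; all
  -- later bounds go through -e < x < e.
  ∣x∣<e-intro : ∀ {x e} → - e < x → x < e → ∣ x ∣ < e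
  ∣x∣<e-intro {x} {e} -e<x x<e with x <? 0#
  ... | yes _ = <-from-difference -e<x (solve 2 (λ x e → x :- (:- e) := e :- (:- x)) refl x e)
  ... | no  _ = x<e

  ∣x∣<e-elim : ∀ {x e} → ∣ x ∣ < e → (- e < x) × (x < e)
  ∣x∣<e-elim {x} {e} h with x <? 0#
  ... | yes x<0 =
      <-from-difference h (solve 2 (λ x e → e :- (:- x) := x :- (:- e)) refl x e)
    , <-trans x<0 (<-trans (<-from-difference x<0
        (solve 1 (λ x → con (+ 0) :- x := (:- x) :- con (+ 0)) refl x)) h)
  ... | no  x≮0 =
      <-≤-trans (<-from-difference (≤-<-trans (≮⇒≥ x≮0) h)
        (solve 1 (λ e → e :- con (+ 0) := con (+ 0) :- (:- e)) refl e)) (≮⇒≥ x≮0)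
    , h

  ∣∣<-cong : ∀ {x y e} → x ≈ y → ∣ x ∣ < e → ∣ y ∣ < e
  ∣∣<-cong x≈y h with ∣x∣<e-elim h
  ... | l , u = ∣x∣<e-intro (<-respʳ-≈ x≈y l) (<-respˡ-≈ x≈y u)

  ∣+∣< : ∀ {x y d e} → ∣ x ∣ < d → ∣ y ∣ < e → ∣ x + y ∣ < d + e
  ∣+∣< {x} {y} {d} {e} hx hy with ∣x∣<e-elim hx | ∣x∣<e-elim hy
  ... | lx , ux | ly , uy = ∣x∣<e-intro
    (<-respˡ-≈ (Additive.⁻¹-∙-comm d e) (+-mono-< lx ly))
    (+-mono-< ux uy)

  ∣-∣< : ∀ {x e} → ∣ x ∣ < e → ∣ - x ∣ < e
  ∣-∣< {x} {e} h with ∣x∣<e-elim h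
  ... | l , u = ∣x∣<e-intro
    (<-from-difference u (solve 2 (λ x e → e :- x := (:- x) :- (:- e)) refl x e))
    (<-from-difference l (solve 2 (λ x e → x :- (:- e) := e :- (:- x)) refl x e))

  x≈y⇒∣x-y∣<e : ∀ {x y e} → 0# < e → x ≈ y → ∣ x - y ∣ < e
  x≈y⇒∣x-y∣<e {x} {y} {e} 0<e x≈y = ∣∣<-cong (sym (Additive.x≈y⇒x∙y⁻¹≈ε x≈y))
    (∣x∣<e-intro (<-from-difference 0<e
       (solve 1 (λ e → e :- con (+ 0) := con (+ 0) :- (:- e)) refl e)) 0<e)

  nonneg⇒∣∣< : ∀ {x e} → 0# ≤ x → x < e → ∣ x ∣ < e
  nonneg⇒∣∣< {x} {e} 0≤x x<e = ∣x∣<e-intro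
    (<-≤-trans (<-from-difference (≤-<-trans 0≤x x<e)
       (solve 1 (λ e → e :- con (+ 0) := con (+ 0) :- (:- e)) refl e)) 0≤x)
    x<e

-- Riemann sums and Riemann integrals on compact intervals.

module Integration {c ℓ₁ ℓ₂} (R : Reals c ℓ₁ ℓ₂) where

  open Reals R
  open OverReals R
  open OrderedField R

  private variable
    a b I J p q : Carrier
    g h : Carrier → Carrier

  MeshBelow-weaken : ∀ {δ δ′} → δ ≤ δ′ → (P : TaggedPartition b a) →
                     MeshBelow δ P → MeshBelow δ′ P
  MeshBelow-weaken δ≤δ′ (end _)          _        = tt
  MeshBelow-weaken δ≤δ′ (cell _ _ _ _ P) (s , ss) =
    <-≤-trans s δ≤δ′ , MeshBelow-weaken δ≤δ′ P ss

  -- Cells run from left to right. This carries membership in an upper set from a partition point to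
  -- the right endpoint `b`.
  partition⇒≤ : TaggedPartition b a → a ≤ b
  partition⇒≤ (end a≈b)            = inj₂ a≈b
  partition⇒≤ (cell _ _ a≤t t≤x P) = ≤-trans a≤t (≤-trans t≤x (partition⇒≤ P))

  riemannSum-cong : (∀ x → g x ≈ h x) → (P : TaggedPartition b a) →
                    riemannSum g P ≈ riemannSum h P
  riemannSum-cong g≈h (end _)          = refl
  riemannSum-cong g≈h (cell t _ _ _ P) = +-cong (*-congʳ (g≈h t)) (riemannSum-cong g≈h P)

  riemannSum-+ : ∀ g h (P : TaggedPartition b a) →
                 riemannSum (λ x → g x + h x) P ≈ riemannSum g P + riemannSum h P
  riemannSum-+ g h (end _) = sym (+-identityˡ 0#)
  riemannSum-+ {a = a} g h (cell t x _ _ P) = trans (+-congˡ (riemannSum-+ g h P))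
    (solve 5 (λ u v w r s → (u :+ v) :* w :+ (r :+ s) := (u :* w :+ r) :+ (v :* w :+ s)) refl
      (g t) (h t) (x - a) (riemannSum g P) (riemannSum h P))

  riemannSum-neg : ∀ g (P : TaggedPartition b a) →
                   riemannSum (λ x → - g x) P ≈ - riemannSum g P
  riemannSum-neg g (end _) = solve 0 (con (+ 0) := :- con (+ 0)) refl
  riemannSum-neg {a = a} g (cell t x _ _ P) = trans (+-congˡ (riemannSum-neg g P))
    (solve 3 (λ u w r → (:- u) :* w :+ (:- r) := :- (u :* w :+ r)) refl
      (g t) (x - a) (riemannSum g P))

  riemannSum-zero : (P : TaggedPartition b a) → riemannSum (λ _ → 0#) P ≈ 0#
  riemannSum-zero (end _)          = refl
  riemannSum-zero (cell _ _ _ _ P) =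
    trans (+-cong (zeroˡ _) (riemannSum-zero P)) (+-identityˡ 0#)

  riemannIntegral-cong : (∀ x → g x ≈ h x) → IsRiemannIntegral g a b I → IsRiemannIntegral h a b I
  riemannIntegral-cong g≈h int ε 0<ε with int ε 0<ε
  ... | δ , 0<δ , close =
    δ , 0<δ , λ P mesh → ∣∣<-cong (+-congʳ (riemannSum-cong g≈h P)) (close P mesh)

  riemannIntegral-+ : IsRiemannIntegral g a b I → IsRiemannIntegral h a b J →
                      IsRiemannIntegral (λ x → g x + h x) a b (I + J)
  riemannIntegral-+ {g = g} {I = I} {h = h} {J = J} intg inth ε 0<ε
    with intg (½ * ε) (*-pos 0<½ 0<ε) | inth (½ * ε) (*-pos 0<½ 0<ε)
  ... | δ₁ , 0<δ₁ , close₁ | δ₂ , 0<δ₂ , close₂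
    with positive-lower-bound δ₁ δ₂ 0<δ₁ 0<δ₂
  ... | δ , 0<δ , δ≤δ₁ , δ≤δ₂ = δ , 0<δ , λ P mesh →
    <-respʳ-≈ (½*x+½*x≈x ε)
      (∣∣<-cong
        (trans (solve 4 (λ r s i j → (r :- i) :+ (s :- j) := (r :+ s) :- (i :+ j)) refl
                 (riemannSum g P) (riemannSum h P) I J)
               (+-congʳ (sym (riemannSum-+ g h P))))
        (∣+∣< (close₁ P (MeshBelow-weaken δ≤δ₁ P mesh))
              (close₂ P (MeshBelow-weaken δ≤δ₂ P mesh))))

  riemannIntegral-neg : IsRiemannIntegral g a b I →
                        IsRiemannIntegral (λ x → - g x) a b (- I)
  riemannIntegral-neg {g = g} {I = I} int ε 0<ε with int ε 0<ε
  ... | δ , 0<δ , close = δ , 0<δ , λ P mesh →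
    ∣∣<-cong (trans (solve 2 (λ r i → :- (r :- i) := (:- r) :- (:- i)) refl (riemannSum g P) I)
                    (+-congʳ (sym (riemannSum-neg g P))))
             (∣-∣< (close P mesh))

  -- Characteristic functions and unit steps.

  χ-∈ : ∀ {ℓ} {A : Pred Carrier ℓ} (A? : Decidable A) {x} → A x → χ A? x ≡ 1#
  χ-∈ A? {x} Ax = ≡.cong (if_then 1# else 0#) (dec-true (A? x) Ax)

  χ-∉ : ∀ {ℓ} {A : Pred Carrier ℓ} (A? : Decidable A) {x} → ¬ A x → χ A? x ≡ 0#
  χ-∉ A? {x} ¬Ax = ≡.cong (if_then 1# else 0#) (dec-false (A? x) ¬Ax)

  χ-⇔ : ∀ {ℓ ℓ′} {A : Pred Carrier ℓ} {B : Pred Carrier ℓ′} (A? : Decidable A) (B? : Decidable B)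
        {x y} → (A x → B y) → (B y → A x) → χ A? x ≈ χ B? y
  χ-⇔ A? B? {x} {y} to from with A? x
  ... | yes Ax = sym (reflexive (χ-∈ B? (to Ax)))
  ... | no ¬Ax = sym (reflexive (χ-∉ B? (¬Ax ∘ from)))

  -- The three points are independent, so shifted indicators can be multiplied directly; an empty
  -- `C` expresses that the product vanishes.
  χ-* : ∀ {ℓ ℓ′ ℓ″} {A : Pred Carrier ℓ} {B : Pred Carrier ℓ′} {C : Pred Carrier ℓ″}
        (A? : Decidable A) (B? : Decidable B) (C? : Decidable C) {x y z} →
        (A x → B y → C z) → (C z → A x × B y) → χ A? x * χ B? y ≈ χ C? z
  χ-* A? B? C? {x} {y} to from with A? x | B? y
  ... | no ¬Ax | _      = trans (zeroˡ _) (sym (reflexive (χ-∉ C? (¬Ax ∘ proj₁ ∘ from))))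
  ... | yes _  | no ¬By = trans (zeroʳ _) (sym (reflexive (χ-∉ C? (¬By ∘ proj₂ ∘ from))))
  ... | yes Ax | yes By = trans (*-identityˡ 1#) (sym (reflexive (χ-∈ C? (to Ax By))))

  -- Only the cell in which a tagged partition enters the upper set contributes
  -- an error, so the Riemann sums of a unit step at p miss the increment of
  -- the antiderivative by less than the mesh.
  module UnitStep {ℓ} {U : Pred Carrier ℓ} (U? : Decidable U) (p : Carrier)
                  (upward : ∀ {x y} → x ≤ y → U x → U y)
                  (∈⇒≥ : ∀ {x} → U x → p ≤ x) (∉⇒≤ : ∀ {x} → ¬ U x → x ≤ p) where

    step : Carrier → Carrier
    step = χ U?

    -- This is max(x - p, 0). `U` is the ray above p, with or without p, and at p both branches give
    -- 0.
    antiderivative : Carrier → Carrier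
    antiderivative x = if does (U? x) then x - p else 0#

    antiderivative-∈ : ∀ {x} → U x → antiderivative x ≈ x - p
    antiderivative-∈ {x} Ux =
      reflexive (≡.cong (if_then x - p else 0#) (dec-true (U? x) Ux))

    antiderivative-∉ : ∀ {x} → ¬ U x → antiderivative x ≈ 0#
    antiderivative-∉ {x} ¬Ux =
      reflexive (≡.cong (if_then x - p else 0#) (dec-false (U? x) ¬Ux))

    -- All tags to the right of a point of `U` lie in `U`, so the sum consists of the cell lengths
    -- and telescopes.
    riemannSum-∈ : U a → (P : TaggedPartition b a) → riemannSum step P ≈ b - a
    riemannSum-∈ {b = b} Ua (end {a} a≈b) =
      ≈-from-difference a≈b (solve 2 (λ a b → con (+ 0) :- (b :- a) := a :- b) refl a b)
    riemannSum-∈ {b = b} Ua (cell {a} t x a≤t t≤x P) =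
      trans (+-cong (trans (*-congʳ (reflexive (χ-∈ U? Ut))) (*-identityˡ (x - a)))
                    (riemannSum-∈ (upward t≤x Ut) P))
            (solve 3 (λ x a b → (x :- a) :+ (b :- x) := b :- a) refl x a b)
      where
      Ut : U t
      Ut = upward a≤t Ua

    -- The cell [a , x] contains p. A tag in `U` overshoots x - p by p - a, and a tag outside `U`
    -- undershoots it by x - p itself; both errors are at most x - a.
    crossing-error : ∀ {δ t x} → ¬ U a → U x → t ≤ x → x - a < δ →
                     ∣ step t * (x - a) - (x - p) ∣ < δ
    crossing-error {a = a} {t = t} {x = x} ¬Ua Ux t≤x x-a<δ with U? t
    ... | yes _ = ∣∣<-cong
      (sym (trans (+-congʳ (*-identityˡ (x - a)))
                  (solve 3 (λ x a p → (x :- a) :- (x :- p) := p :- a) refl x a p)))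
      (nonneg⇒∣∣< (≤-from-difference (∉⇒≤ ¬Ua)
                    (solve 2 (λ a p → p :- a := (p :- a) :- con (+ 0)) refl a p))
                  (≤-<-trans (≤-from-difference (∈⇒≥ Ux)
                    (solve 3 (λ x a p → x :- p := (x :- a) :- (p :- a)) refl x a p)) x-a<δ))
    ... | no _ = ∣∣<-cong
      (solve 3 (λ x a p → :- (x :- p) := con (+ 0) :* (x :- a) :- (x :- p)) refl x a p)
      (∣-∣< (nonneg⇒∣∣< (≤-from-difference (∈⇒≥ Ux)
                    (solve 2 (λ x p → x :- p := (x :- p) :- con (+ 0)) refl x p))
                  (≤-<-trans (≤-from-difference (∉⇒≤ ¬Ua)
                    (solve 3 (λ x a p → p :- a := (x :- a) :- (x :- p)) refl x a p)) x-a<δ)))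

    riemannSum-∉ : ∀ {δ} → 0# < δ → ¬ U a → (P : TaggedPartition b a) → MeshBelow δ P →
                   ∣ riemannSum step P - antiderivative b ∣ < δ
    riemannSum-∉ 0<δ ¬Ua (end a≈b) _ =
      x≈y⇒∣x-y∣<e 0<δ (sym (antiderivative-∉ (¬Ua ∘ upward (inj₂ (sym a≈b)))))
    riemannSum-∉ {b = b} 0<δ ¬Ua (cell {a} t x a≤t t≤x P) (x-a<δ , mesh) with U? x
    -- The cell has not yet reached `U`, and neither has its tag, so it contributes nothing.
    ... | no ¬Ux = ∣∣<-cong
      (+-congʳ (sym (trans
        (+-congʳ (trans (*-congʳ (reflexive (χ-∉ U? (¬Ux ∘ upward t≤x)))) (zeroˡ (x - a))))
        (+-identityˡ _))))
      (riemannSum-∉ 0<δ ¬Ux P mesh)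
    -- The sum over the remaining cells is exactly b - x and the target is b - p, so the error is
    -- that of this cell against x - p.
    ... | yes Ux = ∣∣<-cong
      (trans (solve 4 (λ s x p b → s :- (x :- p) := (s :+ (b :- x)) :- (b :- p)) refl
                (step t * (x - a)) x p b)
        (+-cong (+-congˡ (sym (riemannSum-∈ Ux P)))
                (-‿cong (sym (antiderivative-∈ (upward (partition⇒≤ P) Ux))))))
      (crossing-error ¬Ua Ux t≤x x-a<δ)

    riemannIntegral-step : ∀ a b →
      IsRiemannIntegral step a b (antiderivative b - antiderivative a)
    -- The error stays below the mesh, so δ = ε suffices.
    riemannIntegral-step a b ε 0<ε = ε , 0<ε , close
      where
      close : (P : TaggedPartition b a) → MeshBelow ε P →
              ∣ riemannSum step P - (antiderivative b - antiderivative a) ∣ < ε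
      close P mesh with U? a
      ... | yes Ua = x≈y⇒∣x-y∣<e 0<ε (trans (riemannSum-∈ Ua P)
        (trans (solve 3 (λ a b p → b :- a := (b :- p) :- (a :- p)) refl a b p)
               (+-congʳ (sym (antiderivative-∈ (upward (partition⇒≤ P) Ua))))))
      -- After the case split `antiderivative a` has become `0#`.
      ... | no ¬Ua = ∣∣<-cong
        (+-congˡ (-‿cong (sym (x-0≈x _))))
        (riemannSum-∉ 0<ε ¬Ua P mesh)

  -- Integrals over the whole line.

  integral-cong : (∀ x → g x ≈ h x) → I ≈ J → IsIntegralOverℝ g I → IsIntegralOverℝ h J
  integral-cong g≈h I≈J int = record
    { ∫[_,_]     = ∫[_,_]
    ; isIntegral = λ a b a≤b → riemannIntegral-cong g≈h (isIntegral a b a≤b)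
    ; converges  = λ ε 0<ε → let (M , close) = converges ε 0<ε in
        M , λ a b a≤-M M≤b → ∣∣<-cong (+-congˡ (-‿cong I≈J)) (close a b a≤-M M≤b)
    }
    where open IsIntegralOverℝ int

  integral-zero : IsIntegralOverℝ (λ _ → 0#) 0#
  integral-zero = record
    { ∫[_,_]     = λ _ _ → 0#
    ; isIntegral = λ _ _ _ ε 0<ε → ε , 0<ε , λ P _ → x≈y⇒∣x-y∣<e 0<ε (riemannSum-zero P)
    ; converges  = λ _ 0<ε → 0# , λ _ _ _ _ → x≈y⇒∣x-y∣<e 0<ε refl
    }

  integral-+ : IsIntegralOverℝ g I → IsIntegralOverℝ h J →
               IsIntegralOverℝ (λ x → g x + h x) (I + J)
  integral-+ {g = g} {I = I} {h = h} {J = J} intg inth = record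
    { ∫[_,_]     = λ a b → G.∫[_,_] a b + H.∫[_,_] a b
    ; isIntegral = λ a b a≤b → riemannIntegral-+ (G.isIntegral a b a≤b) (H.isIntegral a b a≤b)
    ; converges  = converges
    }
    where
    module G = IsIntegralOverℝ intg
    module H = IsIntegralOverℝ inth

    converges : ∀ ε → 0# < ε → ∃ λ M → ∀ a b → a ≤ - M → M ≤ b →
                ∣ (G.∫[_,_] a b + H.∫[_,_] a b) - (I + J) ∣ < ε
    converges ε 0<ε
      with G.converges (½ * ε) (*-pos 0<½ 0<ε) | H.converges (½ * ε) (*-pos 0<½ 0<ε)
    ... | M₁ , close₁ | M₂ , close₂ with upper-bound M₁ M₂
    ... | M , M₁≤M , M₂≤M = M , λ a b a≤-M M≤b →
      <-respʳ-≈ (½*x+½*x≈x ε)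
        (∣∣<-cong
          (solve 4 (λ r s i j → (r :- i) :+ (s :- j) := (r :+ s) :- (i :+ j)) refl
            (G.∫[_,_] a b) (H.∫[_,_] a b) I J)
          (∣+∣< (close₁ a b (≤-trans a≤-M (neg-mono-≤ M₁≤M)) (≤-trans M₁≤M M≤b))
                (close₂ a b (≤-trans a≤-M (neg-mono-≤ M₂≤M)) (≤-trans M₂≤M M≤b))))

  -- The indicator of the open interval is the step on (p, ∞) minus the step on [q, ∞); the second
  -- ray is closed so that q itself is removed.
  integral-interval : p < q → IsIntegralOverℝ (χ (openInterval? p q)) (q - p)
  integral-interval {p} {q} p<q = record
    { ∫[_,_]     = ∫
    ; isIntegral = λ a b _ → riemannIntegral-cong steps
        (riemannIntegral-+ (Left.riemannIntegral-step a b)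
                           (riemannIntegral-neg (Right.riemannIntegral-step a b)))
    ; converges  = λ ε 0<ε → M , λ a b a≤-M M≤b → x≈y⇒∣x-y∣<e 0<ε (∫-eventually a≤-M M≤b)
    }
    where
    module Left = UnitStep (λ x → p <? x) p
      (λ x≤y p<x → <-≤-trans p<x x≤y) inj₁ ≮⇒≥
    module Right = UnitStep (λ x → ¬? (x <? q)) q
      (λ x≤y x≮q y<q → x≮q (≤-<-trans x≤y y<q)) ≮⇒≥
      (λ {x} → inj₁ ∘ decidable-stable (x <? q))

    steps : ∀ x → Left.step x + - Right.step x ≈ χ (openInterval? p q) x
    steps x with p <? x | x <? q
    ... | yes _  | yes _  = x-0≈x 1#
    ... | yes _  | no _   = -‿inverseʳ 1#
    ... | no _   | yes _  = x-0≈x 0#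
    -- Such an x would give q ≤ x ≤ p.
    ... | no p≮x | no x≮q = contradiction p<q (≤⇒≯ (≤-trans (≮⇒≥ x≮q) (≮⇒≥ p≮x)))

    ∫ : Carrier → Carrier → Carrier
    ∫ a b = (Left.antiderivative b - Left.antiderivative a)
          + - (Right.antiderivative b - Right.antiderivative a)

    M : Carrier
    -- Since q ≤ M and -M ≤ p, the intervals [a , b] in question contain [p , q], and the integral
    -- over them equals q - p exactly.
    M = proj₁ (upper-bound q (- p))

    ∫-eventually : a ≤ - M → M ≤ b → ∫ a b ≈ q - p
    ∫-eventually {a} {b} a≤-M M≤b =
      trans (+-cong (+-cong (Left.antiderivative-∈ (<-≤-trans p<q q≤b))
                            (-‿cong (Left.antiderivative-∉ (≤⇒≯ a≤p))))
                    (-‿cong (+-cong (Right.antiderivative-∈ (≤⇒≯ q≤b))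
                            (-‿cong (Right.antiderivative-∉ (λ a≮q → a≮q (≤-<-trans a≤p p<q)))))))
            (solve 3 (λ b p q → ((b :- p) :- con (+ 0)) :+ (:- ((b :- q) :- con (+ 0))) := q :- p)
              refl b p q)
      where
      q≤b : q ≤ b
      q≤b = ≤-trans (proj₁ (proj₂ (upper-bound q (- p)))) M≤b
      a≤p : a ≤ p
      a≤p = ≤-trans a≤-M (≤-from-difference (proj₂ (proj₂ (upper-bound q (- p))))
        (solve 2 (λ M p → M :- (:- p) := p :- (:- M)) refl M p))

-- Integrals of products of shifted functions.

module ShiftedProducts {c ℓ₁ ℓ₂} (R : Reals c ℓ₁ ℓ₂) where

  open Reals R
  open OverReals R
  open OrderedField R
  open Integration R

  f-cong : ∀ n {x y} → x ≈ y → f n x ≈ f n y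
  f-cong ℕ.zero    x≈y = χ-⇔ (openInterval? (- ½) ½) (openInterval? (- ½) ½)
    (λ (l , u) → <-respʳ-≈ x≈y l , <-respˡ-≈ x≈y u)
    (λ (l , u) → <-respʳ-≈ (sym x≈y) l , <-respˡ-≈ (sym x≈y) u)
  f-cong (ℕ.suc n) x≈y = +-cong (f-cong n (+-congʳ x≈y)) (f-cong n (+-congʳ x≈y))

  shiftedProduct : ℕ.ℕ → ℕ.ℕ → Carrier → Carrier → Carrier → Carrier
  shiftedProduct n m s t x = f n (x + s) * f m (x + t)

  -- The factors are the indicators of (-1 - t, -t) and (-½ - t, ½ - t), which meet in (-½ - t, -t).
  integral-half-overlap : ∀ t → IsIntegralOverℝ (shiftedProduct 0 0 (t + ½) t) ½
  integral-half-overlap t =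
    integral-cong (λ x → sym (product x))
      (solve 2 (λ h t → (:- t) :- ((:- h) :- t) := h) refl ½ t)
      (integral-interval (<-from-difference 0<½
        (solve 2 (λ h t → h :- con (+ 0) := (:- t) :- ((:- h) :- t)) refl ½ t)))
    where
    product : ∀ x → shiftedProduct 0 0 (t + ½) t x ≈ χ (openInterval? (- ½ - t) (- t)) x
    product x = χ-* (openInterval? (- ½) ½) (openInterval? (- ½) ½) (openInterval? (- ½ - t) (- t))
      (λ (_ , u) (l , _) →
          <-from-difference l
            (solve 3 (λ h t x → (x :+ t) :- (:- h) := x :- ((:- h) :- t)) refl ½ t x)
        , <-from-difference u
            (solve 3 (λ h t x → h :- (x :+ (t :+ h)) := (:- t) :- x) refl ½ t x))
      (λ (l , u) →
          -- Two of the four bounds are the ends of the overlap; the other two are weaker by ½,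
          -- whence the added `0<½`.
          ( <-from-difference (+-mono-< l 0<½)
              (solve 3 (λ h t x → (x :+ h) :- (((:- h) :- t) :+ con (+ 0))
                                  := (x :+ (t :+ h)) :- (:- h)) refl ½ t x)
          , <-from-difference u
              (solve 3 (λ h t x → (:- t) :- x := h :- (x :+ (t :+ h))) refl ½ t x))
        , ( <-from-difference l
              (solve 3 (λ h t x → x :- ((:- h) :- t) := (x :+ t) :- (:- h)) refl ½ t x)
          , <-from-difference (+-mono-< u 0<½)
              (solve 3 (λ h t x → ((:- t) :+ h) :- (x :+ con (+ 0)) := h :- (x :+ t)) refl ½ t x)))

  -- A common point x would satisfy x + s < ½ and -½ < x + t, hence s < t + 1.
  integral-disjoint : ∀ {s t} → t + 1# ≤ s → IsIntegralOverℝ (shiftedProduct 0 0 s t) 0#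
  integral-disjoint {s} {t} t+1≤s = integral-cong (λ x → sym (product x)) refl integral-zero
    where
    product : ∀ x → shiftedProduct 0 0 s t x ≈ 0#
    product x = χ-* {C = λ _ → ⊥}
      (openInterval? (- ½) ½) (openInterval? (- ½) ½) (λ _ → no λ ()) {z = 0#}
      (λ (_ , u) (l , _) → ≤⇒≯ t+1≤s (<-from-difference (+-mono-< u l)
        (≈-from-difference (sym 1≈½+½)
          (solve 5 (λ o h s t x → ((h :+ (x :+ t)) :- ((x :+ s) :+ (:- h))) :- ((t :+ o) :- s)
                                  := (h :+ h) :- o) refl 1# ½ s t x))))
      (λ ())

  -- The hypothesis says s - t = k - ½. For k = 0 and k = 1 the shifts differ by ½, in opposite
  -- directions, and the coefficient is 1. For all other k they differ by at least 3/2, and both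
  -- sides vanish.
  integral-base : ∀ s t k → s - t + 1 ×½ ≈ ι k →
    IsIntegralOverℝ (shiftedProduct 0 0 s t) (½ * fromℕ (binomial 1 k))
  integral-base s t (+ 0) offset = integral-cong
    (λ x → trans (*-comm _ _) (*-congˡ (f-cong 0 (+-congˡ (sym t≈s+½)))))
    (sym (trans (*-congˡ (+-identityʳ 1#)) (*-identityʳ ½)))
    (integral-half-overlap s)
    where
    t≈s+½ : t ≈ s + ½
    t≈s+½ = ≈-from-difference (sym offset)
      (solve 3 (λ h s t → t :- (s :+ h) := con (+ 0) :- (s :- t :+ (h :+ con (+ 0)))) refl ½ s t)
  integral-base s t (+ 1) offset = integral-cong
    (λ x → *-congʳ (f-cong 0 (+-congˡ (sym s≈t+½))))
    (sym (trans (*-congˡ (+-identityʳ 1#)) (*-identityʳ ½)))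
    (integral-half-overlap t)
    where
    s≈t+½ : s ≈ t + ½
    s≈t+½ = ≈-from-difference (+-cong offset 1≈½+½)
      (solve 4 (λ o h s t → s :- (t :+ h)
          := ((s :- t :+ (h :+ con (+ 0))) :+ o) :- ((o :+ con (+ 0)) :+ (h :+ h)))
        refl 1# ½ s t)
  integral-base s t (+ ℕ.suc (ℕ.suc j)) offset = integral-cong (λ _ → refl) (sym (zeroʳ ½))
    -- With k = j + 2, the slack s - (t + 1) is j + ½.
    (integral-disjoint (≤-from-difference (+-mono-≤ (0≤fromℕ j) (inj₁ 0<½))
      (≈-from-difference (+-cong (sym offset) (sym 1≈½+½))
        (solve 5 (λ o h J s t → ((J :+ h) :- (con (+ 0) :+ con (+ 0))) :- (s :- (t :+ o))
            := ((o :+ (o :+ J)) :+ (h :+ h)) :- ((s :- t :+ (h :+ con (+ 0))) :+ o))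
          refl 1# ½ (fromℕ j) s t))))
  integral-base s t -[1+ j ] offset = integral-cong (λ x → *-comm _ _) (sym (zeroʳ ½))
    -- With k = -1 - j, the slack t - (s + 1) is again j + ½.
    (integral-disjoint (≤-from-difference (+-mono-≤ (0≤fromℕ j) (inj₁ 0<½))
      (≈-from-difference offset
        (solve 5 (λ o h J s t → ((J :+ h) :- (con (+ 0) :+ con (+ 0))) :- (t :- (s :+ o))
            := (s :- t :+ (h :+ con (+ 0))) :- (:- (o :+ J)))
          refl 1# ½ (fromℕ j) s t))))

  integral-pascal : ∀ {g} N k →
    IsIntegralOverℝ g (½ * fromℕ (binomial N k) + ½ * fromℕ (binomial N (ℤ.pred k))) →
    IsIntegralOverℝ g (½ * fromℕ (binomial (ℕ.suc N) k))
  integral-pascal N k = integral-cong (λ _ → refl)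
    (trans (sym (distribˡ ½ _ _))
           (*-congˡ (trans (sym (fromℕ-homo-+ (binomial N k) (binomial N (ℤ.pred k))))
                           (reflexive (≡.cong fromℕ (binomial-pascal N k))))))

  -- Lowering n or m by one takes a ½ out of the offset; a shift that raises d = s - t by ½ restores
  -- it, so k is kept.
  offset-raise : ∀ {d} N k → d + ℕ.suc N ×½ ≈ ι k → (d + ½) + N ×½ ≈ ι k
  offset-raise {d} N k offset = trans (+-assoc d ½ (N ×½)) offset

  -- The opposite shift loses a second ½, so k drops by one, giving the other term of Pascal's rule.
  offset-lower : ∀ {d} N k → d + ℕ.suc N ×½ ≈ ι k → (d - ½) + N ×½ ≈ ι (ℤ.pred k)
  offset-lower {d} N k offset = trans
    (≈-from-difference (+-cong offset 1≈½+½)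
      (solve 5 (λ o h d H K → ((d :- h) :+ H) :- (K :- o)
          := ((d :+ (h :+ H)) :+ o) :- (K :+ (h :+ h)))
        refl 1# ½ d (N ×½) (ι k)))
    (sym (ι-pred k))

  -- The first factor is unfolded until n = 0, then the second. Each unfolding replaces the integral
  -- by two with the same total index n + m, one less than before, at k and k - 1.
  integral-shiftedProduct : ∀ n m s t k → s - t + ℕ.suc (n ℕ.+ m) ×½ ≈ ι k →
    IsIntegralOverℝ (shiftedProduct n m s t) (½ * fromℕ (binomial (ℕ.suc (n ℕ.+ m)) k))
  integral-shiftedProduct ℕ.zero ℕ.zero s t k offset = integral-base s t k offset
  integral-shiftedProduct ℕ.zero (ℕ.suc m) s t k offset =
    integral-pascal (ℕ.suc m) k (integral-cong split refl (integral-+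
      -- As t enters s - t negatively, t - ½ is the shift that keeps k; `split` therefore swaps the
      -- two summands of the recursion.
      (integral-shiftedProduct 0 m s (t - ½) k
        (trans (+-congʳ (solve 3 (λ h s t → s :- (t :- h) := (s :- t) :+ h) refl ½ s t))
               (offset-raise (ℕ.suc m) k offset)))
      (integral-shiftedProduct 0 m s (t + ½) (ℤ.pred k)
        (trans (+-congʳ (solve 3 (λ h s t → s :- (t :+ h) := (s :- t) :- h) refl ½ s t))
               (offset-lower (ℕ.suc m) k offset)))))
    where
    split : ∀ x → shiftedProduct 0 m s (t - ½) x + shiftedProduct 0 m s (t + ½) x
                ≈ shiftedProduct 0 (ℕ.suc m) s t x
    split x = trans (sym (distribˡ _ _ _)) (*-congˡ (trans (+-comm _ _)
      (+-cong (f-cong m (sym (+-assoc x t ½))) (f-cong m (sym (+-assoc x t (- ½)))))))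
  integral-shiftedProduct (ℕ.suc n) m s t k offset =
    integral-pascal (ℕ.suc (n ℕ.+ m)) k (integral-cong split refl (integral-+
      (integral-shiftedProduct n m (s + ½) t k
        (trans (+-congʳ (solve 3 (λ h s t → (s :+ h) :- t := (s :- t) :+ h) refl ½ s t))
               (offset-raise (ℕ.suc (n ℕ.+ m)) k offset)))
      (integral-shiftedProduct n m (s - ½) t (ℤ.pred k)
        (trans (+-congʳ (solve 3 (λ h s t → (s :- h) :- t := (s :- t) :- h) refl ½ s t))
               (offset-lower (ℕ.suc (n ℕ.+ m)) k offset)))))
    where
    split : ∀ x → shiftedProduct n m (s + ½) t x + shiftedProduct n m (s - ½) t x
                ≈ shiftedProduct (ℕ.suc n) m s t x
    split x = trans (sym (distribʳ _ _ _)) (*-congʳ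
      (+-cong (f-cong n (sym (+-assoc x s ½))) (f-cong n (sym (+-assoc x s (- ½))))))

  -- At s = t = 0 the offset is half of n + m + 1, which the evenness hypothesis identifies with k.
  integral-f*f : ∀ n m k → ℕ.suc (n ℕ.+ m) ≡ k ℕ.* 2 →
    IsIntegralOverℝ (λ x → f n x * f m x) (½ * fromℕ (ℕ.suc (n ℕ.+ m) ℕ.C k))
  integral-f*f n m k even = integral-cong
    (λ x → *-cong (f-cong n (+-identityʳ x)) (f-cong m (+-identityʳ x)))
    refl
    (integral-shiftedProduct n m 0# 0# (+ k)
      (trans (+-cong (-‿inverseʳ 0#) (reflexive (≡.cong _×½ even)))
             (trans (+-identityˡ _) (×½-double k))))

-- Parity of the indices and the theorem.

open import Data.Nat.Base using (ℕ; _≤_; _+_; _∸_)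
open import Data.Nat.DivMod using (_/_; _%_)
open import Data.Nat.Combinatorics using (_C_)

-- With n - m = 2h + 1, the sum n + m + 1 = (n - m) + 2m + 1 equals 2(1 + m + h).
n+m+1≡[1+m+[n∸m]/2]*2 : ∀ n m → m ≤ n → (n ∸ m) % 2 ≡ 1 → n + m + 1 ≡ (1 + m + (n ∸ m) / 2) ℕ.* 2
n+m+1≡[1+m+[n∸m]/2]*2 n m m≤n odd = begin
  n + m + 1                             ≡⟨ ≡.cong (λ z → z + m + 1) (ℕ.m∸n+n≡m m≤n) ⟨
  (n ∸ m) + m + m + 1                   ≡⟨ ≡.cong (λ z → z + m + m + 1) (ℕ.m≡m%n+[m/n]*n (n ∸ m) 2) ⟩
  ((n ∸ m) % 2 + h ℕ.* 2) + m + m + 1   ≡⟨ ≡.cong (λ z → (z + h ℕ.* 2) + m + m + 1) odd ⟩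
  (1 + h ℕ.* 2) + m + m + 1             ≡⟨ regroup h m ⟩
  (1 + m + h) ℕ.* 2                     ∎
  where
  open ≡.≡-Reasoning
  h : ℕ
  h = (n ∸ m) / 2
  regroup : ∀ h m → (1 + h ℕ.* 2) + m + m + 1 ≡ (1 + m + h) ℕ.* 2
  regroup = solve-∀

mainTheorem6 : ∀ {c ℓ₁ ℓ₂} (R : Reals c ℓ₁ ℓ₂) →
    let open Reals R using () renaming (_*_ to _·_)
        open OverReals R
    in (n m : ℕ) → m ≤ n → (n ∸ m) % 2 ≡ 1 →
       IsIntegralOverℝ (λ x → f n x · f m x)
         (½ · fromℕ ((n + m + 1) C ((n + m + 1) / 2)))
mainTheorem6 R n m m≤n odd =
  -- Only the upper index is rewritten from `suc (n + m)` to `n + m + 1`; the lower index is already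
  -- in final form.
  ≡.subst (λ N → IsIntegralOverℝ (λ x → f n x · f m x) (½ · fromℕ (N C ((n + m + 1) / 2))))
    (ℕ.+-comm 1 (n + m))
    (ShiftedProducts.integral-f*f R n m ((n + m + 1) / 2)
      (≡.trans (ℕ.+-comm 1 (n + m)) (≡.trans even (≡.cong (ℕ._* 2) (≡.sym half)))))
  where
  open Reals R using () renaming (_*_ to _·_)
  open OverReals R
  even : n + m + 1 ≡ (1 + m + (n ∸ m) / 2) ℕ.* 2
  even = n+m+1≡[1+m+[n∸m]/2]*2 n m m≤n odd
  half : (n + m + 1) / 2 ≡ 1 + m + (n ∸ m) / 2
  half = ≡.trans (≡.cong (_/ 2) even) (ℕ.m*n/n≡m (1 + m + (n ∸ m) / 2) 2)
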